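{- Let $p>3$ be prime. For $t\in\mathbb{Z}/p\mathbb{Z}$ put $a_t(p)=-\sum_{x\bmod p}\left(\frac{x^3+t^2}{p}\right)$ and $A_2(p)=\sum_{t\bmod p}a_t(p)^2$. Then $A_2(p)=2p^2-2p$ if $p\equiv 1\pmod 3$, and $A_2(p)=0$ if $p\equiv 2 \pmod 3$.
   Context: $\left(\frac{\cdot}{p}\right)$ denotes the Legendre symbol (equal to $0$ at multiples of $p$). -}

module Defs where

open import Data.Fin.Base using (Fin; toℕ)
open import Data.Fin.Properties using (any?)
open import Data.Integer.Base using (ℤ; +_; -_; _+_; _-_; _^_; 0ℤ; 1ℤ; -1ℤ)
open import Data.Integer.Divisibility.Signed using (_∣_; _∣?_)
open import Data.Integer.Properties using (+-*-semiring)
open import Data.Nat.Base using (ℕ)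
open import Data.Product.Base using (∃-syntax)
open import Relation.Nullary.Decidable.Core using (Dec; yes; no)

open import Algebra.Properties.Semiring.Sum +-*-semiring using (sum-syntax)

-- ℤ/pℤ is represented by Fin p, each class by its least non-negative residue.
-- All arithmetic below takes place in ℤ; it is read modulo p only by the
-- Legendre symbol, which depends only on the class of its argument.

residue : ∀ {p} → Fin p → ℤ
residue x = + toℕ x

IsSquareMod : ℕ → ℤ → Set
IsSquareMod p a = ∃[ y ] + p ∣ residue {p} y ^ 2 - a

isSquareMod? : ∀ p a → Dec (IsSquareMod p a)
isSquareMod? p a = any? (λ y → + p ∣? residue y ^ 2 - a)

-- The Legendre symbol (a / p); meaningful only for p an odd prime.
legendre : ℤ → ℕ → ℤ
legendre a p with + p ∣? a | isSquareMod? p a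
... | yes _ | _     = 0ℤ
... | no _  | yes _ = 1ℤ
... | no _  | no _  = -1ℤ

aₜ : (p : ℕ) → Fin p → ℤ
aₜ p t = - (∑[ x < p ] legendre (residue x ^ 3 + residue t ^ 2) p)

A₂ : ℕ → ℤ
A₂ p = ∑[ t < p ] (aₜ p t ^ 2)

{-# OPTIONS --safe #-}

-- Write χ for the Legendre symbol and S(b) = ∑ₓ χ(x³ + b), so that A₂(p) = ∑ₜ S(t²)² = ∑_b (1 + χ(b)) S(b)².
-- For a nonresidue d, S(d³b) = -S(b), so replacing b by d³b shows ∑_b χ(b) S(b)² = 0. Expanding
-- ∑_b S(b)² and using ∑_b χ(b) χ(b + c) = p [p ∣ c] - 1 gives A₂(p) = p N - p² with N = #{(x, y) : x³ = y³}.
-- If there is a primitive cube root of unity w then N = 3p - 2, and otherwise N = p. Multiplication by w is a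
-- map of order three fixing only 0, so w forces p ≡ 1 (mod 3); without w the order-three map x ↦ -1/(1 + x)
-- of the projective line has no fixed point, and p ≡ 2 (mod 3).

module Submission where

open import Defs
open import Data.Integer.Base using (+_; _-_; _*_; _^_; 0ℤ)
open import Data.Nat.Base using (ℕ; _<_; _%_)
open import Data.Nat.Primality using (Prime)
open import Data.Product.Base using (_×_)
open import Relation.Binary.PropositionalEquality.Core using (_≡_)

open import Data.Empty using (⊥; ⊥-elim)
open import Data.Fin.Base as Fin using (Fin; zero; suc; toℕ; fromℕ<)
open import Data.Fin.Permutation using (permutation)
import Data.Fin.Properties as Fin
open import Data.Integer.Base as ℤ using (ℤ; _+_; -_; 1ℤ; -1ℤ)
open import Data.Integer.Divisibility.Signed
import Data.Integer.DivMod as ℤ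
import Data.Integer.Properties as ℤ
open import Algebra.Properties.AbelianGroup ℤ.+-0-abelianGroup using (identityʳ-unique; inverseˡ-unique)
open import Algebra.Properties.Semiring.Sum ℤ.+-*-semiring
open import Data.Integer.Tactic.RingSolver using (solve; solve-∀)
open import Data.List.Base using ([]; _∷_)
open import Data.Nat.Base as ℕ using (NonZero)
import Data.Nat.DivMod as ℕ
import Data.Nat.Divisibility as ℕ
open import Data.Nat.Primality using (prime⇒nonZero; euclidsLemma)
import Data.Nat.Properties as ℕ
open import Data.Product.Base using (∃-syntax; _,_; proj₁; proj₂)
open import Data.Sum.Base using (_⊎_; inj₁; inj₂; [_,_]′)
open import Function.Base using (_∘_)
open import Function.Definitions using (Injective)
open import Relation.Binary.Definitions using (tri<; tri≈; tri>)
open import Relation.Binary.PropositionalEquality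
  using (_≢_; refl; sym; trans; cong; cong₂; subst; module ≡-Reasoning)
open import Relation.Nullary using (¬_; Dec; yes; no; contradiction)
open import Relation.Nullary.Decidable using (_×-dec_; from-no)

-- Finite sums of integers

∑-const : ∀ n c → ∑[ i < n ] c ≡ + n * c
∑-const ℕ.zero    c = refl
∑-const (ℕ.suc n) c = trans (cong (_+_ c) (∑-const n c)) (sym (ℤ.suc-* (+ n) c))

∑-single : ∀ {n} (f : Fin n → ℤ) i → (∀ j → j ≢ i → f j ≡ 0ℤ) → sum f ≡ f i
∑-single {ℕ.suc n} f zero    f≡0 = trans
  (cong (_+_ (f zero)) (trans (sum-cong-≗ (λ j → f≡0 (suc j) λ ())) (sum-replicate-zero n)))
  (ℤ.+-identityʳ (f zero))
∑-single {ℕ.suc n} f (suc i) f≡0 = trans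
  (cong₂ _+_ (f≡0 zero λ ()) (∑-single (f ∘ suc) i λ j j≢i → f≡0 (suc j) (j≢i ∘ Fin.suc-injective)))
  (ℤ.+-identityˡ (f (suc i)))

∑-nonPositive : ∀ {n} (f : Fin n → ℤ) → (∀ i → f i ℤ.≤ 0ℤ) → sum f ℤ.≤ 0ℤ
∑-nonPositive {ℕ.zero}  f f≤0 = ℤ.≤-refl
∑-nonPositive {ℕ.suc n} f f≤0 = ℤ.+-mono-≤ (f≤0 zero) (∑-nonPositive (f ∘ suc) (f≤0 ∘ suc))

-- The tail sum is nonpositive, so a vanishing total bounds the head from below by 0. This turns
-- vanishing character sums into pointwise identities.
∑-nonPositive-≡0 : ∀ {n} (f : Fin n → ℤ) → (∀ i → f i ℤ.≤ 0ℤ) → sum f ≡ 0ℤ → ∀ i → f i ≡ 0ℤ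
∑-nonPositive-≡0 {ℕ.suc n} f f≤0 ∑≡0 = λ
  { zero    → head≡0
  ; (suc i) → ∑-nonPositive-≡0 (f ∘ suc) (f≤0 ∘ suc) tail≡0 i }
  where
  open ℤ.≤-Reasoning
  tail≤0 = ∑-nonPositive (f ∘ suc) (f≤0 ∘ suc)
  head≡0 : f zero ≡ 0ℤ
  head≡0 = ℤ.≤-antisym (f≤0 zero) (begin
    0ℤ                     ≡⟨ ∑≡0 ⟨
    f zero + sum (f ∘ suc) ≤⟨ ℤ.+-monoʳ-≤ (f zero) tail≤0 ⟩
    f zero + 0ℤ            ≡⟨ ℤ.+-identityʳ (f zero) ⟩
    f zero                 ∎)
  tail≡0 : sum (f ∘ suc) ≡ 0ℤ
  tail≡0 = trans (sym (trans (cong (_+ sum (f ∘ suc)) head≡0) (ℤ.+-identityˡ _))) ∑≡0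

-- If `y` were missed, punching it out of the codomain would give an injection into a smaller finite
-- set, against the pigeonhole principle.
injective⇒surjective : ∀ {n} (f : Fin n → Fin n) → Injective _≡_ _≡_ f → ∀ y → ∃[ x ] f x ≡ y
injective⇒surjective {ℕ.suc n} f inj y with Fin.any? (λ x → f x Fin.≟ y)
... | yes hit  = hit
... | no  miss = contradiction
  (λ {i} {j} → inj ∘ Fin.punchOut-injective (y≢ i) (y≢ j)) (Fin.<⇒notInjective (ℕ.n<1+n n))
  where
  y≢ : ∀ x → y ≢ f x
  y≢ x y≡fx = miss (x , sym y≡fx)

∑-injective : ∀ {n} (f : Fin n → ℤ) (π : Fin n → Fin n) → Injective _≡_ _≡_ π → sum (f ∘ π) ≡ sum f
∑-injective f π inj = sym (sum-permute f (permutation π π⁻¹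
  (λ y → proj₂ (surj y)) (λ x → inj (proj₂ (surj (π x))))))
  where
  surj = injective⇒surjective π inj
  π⁻¹ = proj₁ ∘ surj

-- Indicators

indicator : ∀ {ℓ} {P : Set ℓ} → Dec P → ℤ
indicator (yes _) = 1ℤ
indicator (no _)  = 0ℤ

indicator-yes : ∀ {ℓ} {P : Set ℓ} (P? : Dec P) → P → indicator P? ≡ 1ℤ
indicator-yes (yes _) p = refl
indicator-yes (no ¬p) p = contradiction p ¬p

indicator-no : ∀ {ℓ} {P : Set ℓ} (P? : Dec P) → ¬ P → indicator P? ≡ 0ℤ
indicator-no (yes p) ¬p = contradiction p ¬p
indicator-no (no _)  ¬p = refl

indicator-cong : ∀ {ℓ ℓ′} {P : Set ℓ} {Q : Set ℓ′} (P? : Dec P) (Q? : Dec Q) →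
                 (P → Q) → (Q → P) → indicator P? ≡ indicator Q?
indicator-cong P? (yes q) to from = indicator-yes P? (from q)
indicator-cong P? (no ¬q) to from = indicator-no P? (¬q ∘ to)

-- Counting fixed points of a map of order three

least? : ∀ {n} (a b c : Fin n) → Dec (a Fin.< b × a Fin.< c)
least? a b c = (a Fin.<? b) ×-dec (a Fin.<? c)

-- The cyclic arrangement of the arguments is the one obtained by starting an orbit of an
-- order-three map at each of its points in turn.
one-least : ∀ {n} (a b c : Fin n) → a ≢ b → b ≢ c → c ≢ a →
            indicator (least? a b c) + indicator (least? b c a) + indicator (least? c a b) ≡ 1ℤ
one-least a b c a≢b b≢c c≢a with Fin.<-cmp a b | Fin.<-cmp b c | Fin.<-cmp c a
... | tri≈ _ a≡b _   | _              | _              = contradiction a≡b a≢b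
... | _              | tri≈ _ b≡c _   | _              = contradiction b≡c b≢c
... | _              | _              | tri≈ _ c≡a _   = contradiction c≡a c≢a
... | tri< a<b _ a≯b | _              | tri> c≮a _ a<c
  rewrite indicator-yes (least? a b c) (a<b , a<c)
        | indicator-no (least? b c a) (a≯b ∘ proj₂)
        | indicator-no (least? c a b) (c≮a ∘ proj₁) = refl
... | tri< a<b _ a≯b | _              | tri< c<a _ c≯a
  rewrite indicator-no (least? a b c) (c≯a ∘ proj₂)
        | indicator-no (least? b c a) (a≯b ∘ proj₂)
        | indicator-yes (least? c a b) (c<a , ℕ.<-trans c<a a<b) = refl
... | tri> a≮b _ b<a | tri< b<c _ b≯c | _
  rewrite indicator-no (least? a b c) (a≮b ∘ proj₁)
        | indicator-yes (least? b c a) (b<c , b<a)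
        | indicator-no (least? c a b) (b≯c ∘ proj₂) = refl
... | tri> a≮b _ b<a | tri> b≮c _ c<b | _
  rewrite indicator-no (least? a b c) (a≮b ∘ proj₁)
        | indicator-no (least? b c a) (b≮c ∘ proj₁)
        | indicator-yes (least? c a b) (ℕ.<-trans c<b b<a , c<b) = refl

-- The least elements of the three-element orbits are counted by M.
fixedPoints-order3 : ∀ {n} (f : Fin n → Fin n) → (∀ x → f (f (f x)) ≡ x) →
                     ∃[ M ] + n ≡ ∑[ x < n ] indicator (f x Fin.≟ x) + + 3 * M
fixedPoints-order3 {n} f f³≡id = sum lead , (begin
  + n                                     ≡⟨ trans (∑-const n 1ℤ) (ℤ.*-identityʳ (+ n)) ⟨
  ∑[ x < n ] 1ℤ                           ≡⟨ sum-cong-≗ split ⟨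
  ∑[ x < n ] (fix x + (lead x + (lead (f x) + lead (f (f x)))))
    ≡⟨ ∑-distrib-+ fix (λ x → lead x + (lead (f x) + lead (f (f x)))) ⟩
  sum fix + ∑[ x < n ] (lead x + (lead (f x) + lead (f (f x))))
    ≡⟨ cong (_+_ (sum fix)) (∑-distrib-+ lead (λ x → lead (f x) + lead (f (f x)))) ⟩
  sum fix + (sum lead + ∑[ x < n ] (lead (f x) + lead (f (f x))))
    ≡⟨ cong (λ s → sum fix + (sum lead + s)) (∑-distrib-+ (lead ∘ f) (lead ∘ f ∘ f)) ⟩
  sum fix + (sum lead + (sum (lead ∘ f) + sum (lead ∘ f ∘ f)))
    ≡⟨ cong₂ (λ s s′ → sum fix + (sum lead + (s + s′)))
         (∑-injective lead f inj) (∑-injective lead (f ∘ f) (inj ∘ inj)) ⟩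
  sum fix + (sum lead + (sum lead + sum lead))
    ≡⟨ cong (_+_ (sum fix)) (triple (sum lead)) ⟩
  sum fix + + 3 * sum lead ∎)
  where
  open ≡-Reasoning
  fix lead : Fin n → ℤ
  fix x  = indicator (f x Fin.≟ x)
  lead x = indicator (least? x (f x) (f (f x)))

  triple : ∀ a → a + (a + a) ≡ + 3 * a
  triple = solve-∀

  inj : Injective _≡_ _≡_ f
  inj {x} {y} fx≡fy = trans (sym (f³≡id x)) (trans (cong (f ∘ f) fx≡fy) (f³≡id y))

  -- At a fixed point the strict inequalities in `least?` make all `lead` terms vanish. At any other
  -- point the three iterates are pairwise distinct, and rewriting by `f³≡id` closes the cycle so
  -- that `one-least` applies.
  split : ∀ x → fix x + (lead x + (lead (f x) + lead (f (f x)))) ≡ 1ℤ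
  split x rewrite f³≡id x with f x Fin.≟ x
  ... | yes fx≡x rewrite fx≡x | fx≡x
    | indicator-no (least? x x x) (Fin.<-irrefl refl ∘ proj₁) = refl
  ... | no fx≢x = trans
    (trans (ℤ.+-identityˡ _) (sym (ℤ.+-assoc (lead x) _ _)))
    (one-least x (f x) (f (f x)) (fx≢x ∘ sym) (fx≢x ∘ sym ∘ inj)
      (λ ffx≡x → fx≢x (trans (cong f (sym ffx≡x)) (f³≡id x))))

module Residues (p : ℕ) (p-prime : Prime p) where

  private instance
    p≢0 : NonZero p
    p≢0 = prime⇒nonZero p-prime

  -- Congruence modulo p

  infix 4 _≈_
  -- A record rather than a synonym, so that unification can recover `a` and `b` from the type of a
  -- congruence.
  record _≈_ (a b : ℤ) : Set where
    constructor mod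
    field divides-difference : + p ∣ a - b
  open _≈_

  -- The form in which most divisibilities below are proved: coefficients `k` and `l` are supplied
  -- as a certificate, and the ring solver checks the resulting polynomial identity.
  ∣-combine : ∀ {a u v} k l → + p ∣ u → + p ∣ v → a ≡ k * u + l * v → + p ∣ a
  ∣-combine k l p∣u p∣v refl = ∣m∣n⇒∣m+n (∣n⇒∣m*n k p∣u) (∣n⇒∣m*n l p∣v)

  ∣-multiple : ∀ {a u} k → + p ∣ u → a ≡ k * u → + p ∣ a
  ∣-multiple k p∣u refl = ∣n⇒∣m*n k p∣u

  p∣0 : + p ∣ 0ℤ
  p∣0 = divides 0ℤ refl

  ≈-reflexive : ∀ {a b} → a ≡ b → a ≈ b
  ≈-reflexive {a} refl = mod (subst (+ p ∣_) (sym (ℤ.+-inverseʳ a)) p∣0)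

  ≈-refl : ∀ {a} → a ≈ a
  ≈-refl = ≈-reflexive refl

  ≈-sym : ∀ {a b} → a ≈ b → b ≈ a
  ≈-sym {a} {b} (mod d) = mod (∣-multiple -1ℤ d (solve (a ∷ b ∷ [])))

  ≈-trans : ∀ {a b c} → a ≈ b → b ≈ c → a ≈ c
  ≈-trans {a} {b} {c} (mod d) (mod e) = mod (∣-combine 1ℤ 1ℤ d e (solve (a ∷ b ∷ c ∷ [])))

  +-cong : ∀ {a b c d} → a ≈ b → c ≈ d → a + c ≈ b + d
  +-cong {a} {b} {c} {d} (mod e) (mod f) = mod (∣-combine 1ℤ 1ℤ e f (solve (a ∷ b ∷ c ∷ d ∷ [])))

  *-cong : ∀ {a b c d} → a ≈ b → c ≈ d → a * c ≈ b * d
  *-cong {a} {b} {c} {d} (mod e) (mod f) = mod (∣-combine c b e f (solve (a ∷ b ∷ c ∷ d ∷ [])))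

  ∣⇒≈0 : ∀ {a} → + p ∣ a → a ≈ 0ℤ
  ∣⇒≈0 {a} d = mod (subst (+ p ∣_) (sym (ℤ.+-identityʳ a)) d)

  ≈0⇒∣ : ∀ {a} → a ≈ 0ℤ → + p ∣ a
  ≈0⇒∣ {a} (mod d) = subst (+ p ∣_) (ℤ.+-identityʳ a) d

  ∣-resp-≈ : ∀ {a b} → a ≈ b → + p ∣ a → + p ∣ b
  ∣-resp-≈ a≈b p∣a = ≈0⇒∣ (≈-trans (≈-sym a≈b) (∣⇒≈0 p∣a))

  prime-∣ : ∀ a b → + p ∣ a * b → + p ∣ a ⊎ + p ∣ b
  prime-∣ a b d with euclidsLemma ℤ.∣ a ∣ ℤ.∣ b ∣ p-prime (subst (p ℕ.∣_) (ℤ.abs-* a b) (∣⇒∣ᵤ d))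
  ... | inj₁ e = inj₁ (∣ᵤ⇒∣ e)
  ... | inj₂ e = inj₂ (∣ᵤ⇒∣ e)

  square-∣ : ∀ a → + p ∣ a * a → + p ∣ a
  square-∣ a = [ (λ d → d) , (λ d → d) ]′ ∘ prime-∣ a a

  *-cancel-∣ : ∀ {a} b → ¬ + p ∣ a → + p ∣ a * b → + p ∣ b
  *-cancel-∣ {a} b p∤a d = [ (λ e → contradiction e p∤a) , (λ e → e) ]′ (prime-∣ a b d)

  ⟦_⟧ : ℤ → Fin p
  ⟦ a ⟧ = fromℕ< (ℤ.n%ℕd<d a p)

  residue-⟦⟧ : ∀ a → residue ⟦ a ⟧ ≈ a
  residue-⟦⟧ a = mod (divides (- (a ℤ./ℕ p)) (begin
    + toℕ ⟦ a ⟧ - a         ≡⟨ cong (λ r → + r - a) (Fin.toℕ-fromℕ< (ℤ.n%ℕd<d a p)) ⟩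
    + (a ℤ.%ℕ p) - a        ≡⟨ rearrange a (+ (a ℤ.%ℕ p)) (a ℤ./ℕ p) (+ p) (ℤ.a≡a%ℕn+[a/ℕn]*n a p) ⟩
    - (a ℤ./ℕ p) * + p      ∎))
    where
    open ≡-Reasoning
    rearrange : ∀ a r q m → a ≡ r + q * m → r - a ≡ - q * m
    rearrange a r q m refl = solve (r ∷ q ∷ m ∷ [])

  -- Least residues differ by less than `p` in absolute value, and the only multiple of `p` that
  -- small is 0.
  residue-injective : ∀ {x y : Fin p} → residue x ≈ residue y → x ≡ y
  residue-injective {x} {y} (mod d) = Fin.toℕ-injective (ℤ.+-injective (ℤ.i-j≡0⇒i≡j _ _
    (ℤ.∣i∣≡0⇒i≡0 (small-multiple (∣⇒∣ᵤ d) distance<p))))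
    where
    small-multiple : ∀ {m} → p ℕ.∣ m → m < p → m ≡ 0
    small-multiple {ℕ.zero}  _   _   = refl
    small-multiple {ℕ.suc m} p∣m m<p = contradiction p∣m (ℕ.>⇒∤ m<p)
    distance<p : ℤ.∣ residue x - residue y ∣ < p
    distance<p = subst (λ z → ℤ.∣ z ∣ < p) (sym (ℤ.m-n≡m⊖n (toℕ x) (toℕ y)))
      (ℕ.≤-<-trans (ℤ.∣m⊝n∣≤m⊔n (toℕ x) (toℕ y)) (ℕ.⊔-pres-<m (Fin.toℕ<n x) (Fin.toℕ<n y)))

  -- Sums over residues

  -- Functions on ℤ that descend to ℤ/pℤ. Summands are kept as functions of integers so that
  -- substitutions and ring identities take place in ℤ.
  Periodic : (ℤ → ℤ) → Set
  Periodic F = ∀ {a b} → a ≈ b → F a ≡ F b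

  ∑ₚ : (ℤ → ℤ) → ℤ
  ∑ₚ F = ∑[ x < p ] F (residue x)

  ∑ₚ-cong : ∀ {F G} → (∀ a → F a ≡ G a) → ∑ₚ F ≡ ∑ₚ G
  ∑ₚ-cong F≡G = sum-cong-≗ {p} (λ x → F≡G (residue x))

  ∑ₚ-+ : ∀ F G → ∑ₚ (λ a → F a + G a) ≡ ∑ₚ F + ∑ₚ G
  ∑ₚ-+ F G = ∑-distrib-+ {p} (F ∘ residue) (G ∘ residue)

  ∑ₚ-*ˡ : ∀ k F → ∑ₚ (λ a → k * F a) ≡ k * ∑ₚ F
  ∑ₚ-*ˡ k F = sym (*-distribˡ-sum {p} k (F ∘ residue))

  ∑ₚ-*ʳ : ∀ k F → ∑ₚ (λ a → F a * k) ≡ ∑ₚ F * k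
  ∑ₚ-*ʳ k F = sym (*-distribʳ-sum {p} k (F ∘ residue))

  ∑ₚ-const : ∀ c → ∑ₚ (λ _ → c) ≡ + p * c
  ∑ₚ-const = ∑-const p

  ∑ₚ-comm : ∀ (F : ℤ → ℤ → ℤ) → ∑ₚ (λ a → ∑ₚ (λ b → F a b)) ≡ ∑ₚ (λ b → ∑ₚ (λ a → F a b))
  ∑ₚ-comm F = ∑-comm {p} {p} (λ x y → F (residue x) (residue y))

  ∑ₚ-zero : ∀ F → (∀ a → F a ≡ 0ℤ) → ∑ₚ F ≡ 0ℤ
  ∑ₚ-zero F F≡0 = trans (∑ₚ-cong F≡0) (sum-replicate-zero p)

  -- Reducing `φ` modulo `p` gives an injective self-map of `Fin p`, hence a permutation;
  -- periodicity of `F` absorbs the reduction.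
  ∑ₚ-substitute : ∀ {F} → Periodic F → (φ : ℤ → ℤ) → (∀ {a b} → φ a ≈ φ b → a ≈ b) →
                  ∑ₚ (F ∘ φ) ≡ ∑ₚ F
  ∑ₚ-substitute {F} F-per φ φ-inj = begin
    ∑[ x < p ] F (φ (residue x))             ≡⟨ sum-cong-≗ {p} (λ x → F-per (residue-⟦⟧ (φ (residue x)))) ⟨
    ∑[ x < p ] F (residue ⟦ φ (residue x) ⟧) ≡⟨ ∑-injective (F ∘ residue) (λ x → ⟦ φ (residue x) ⟧) inj ⟩
    ∑ₚ F                                     ∎
    where
    open ≡-Reasoning
    inj : Injective _≡_ _≡_ (λ x → ⟦ φ (residue x) ⟧)
    inj {x} {y} eq = residue-injective (φ-inj (≈-trans (≈-sym (residue-⟦⟧ (φ (residue x))))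
      (≈-trans (≈-reflexive (cong residue eq)) (residue-⟦⟧ (φ (residue y))))))

  ∑ₚ-shift : ∀ {F} → Periodic F → ∀ c → ∑ₚ (λ a → F (a + c)) ≡ ∑ₚ F
  ∑ₚ-shift F-per c = ∑ₚ-substitute F-per (_+ c) λ { {a} {b} (mod d) →
    mod (∣-multiple 1ℤ d (solve (a ∷ b ∷ c ∷ []))) }

  *-cancel-≈ : ∀ {c a b} → ¬ + p ∣ c → c * a ≈ c * b → a ≈ b
  *-cancel-≈ {c} {a} {b} p∤c (mod d) =
    mod (*-cancel-∣ (a - b) p∤c (∣-multiple 1ℤ d (solve (a ∷ b ∷ c ∷ []))))

  ∑ₚ-scale : ∀ {F} → Periodic F → ∀ c → ¬ + p ∣ c → ∑ₚ (λ a → F (c * a)) ≡ ∑ₚ F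
  ∑ₚ-scale F-per c p∤c = ∑ₚ-substitute F-per (c *_) (*-cancel-≈ p∤c)

  -- Multiplication by `c` is injective on a finite set, so it attains the class of 1.
  inverse : ∀ c → ¬ + p ∣ c → ∃[ y ] c * y ≈ 1ℤ
  inverse c p∤c =
    let x , cx≡1 = injective⇒surjective (λ x → ⟦ c * residue x ⟧) inj ⟦ 1ℤ ⟧
    in residue x , ≈-trans (≈-sym (residue-⟦⟧ (c * residue x)))
         (≈-trans (≈-reflexive (cong residue cx≡1)) (residue-⟦⟧ 1ℤ))
    where
    inj : Injective _≡_ _≡_ (λ x → ⟦ c * residue x ⟧)
    inj {x} {y} eq = residue-injective (*-cancel-≈ p∤c (≈-trans (≈-sym (residue-⟦⟧ (c * residue x)))
      (≈-trans (≈-reflexive (cong residue eq)) (residue-⟦⟧ (c * residue y)))))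

  ∑ₚ-nonPositive-≡0 : ∀ {F} → Periodic F → (∀ a → F a ℤ.≤ 0ℤ) → ∑ₚ F ≡ 0ℤ → ∀ a → F a ≡ 0ℤ
  ∑ₚ-nonPositive-≡0 {F} F-per F≤0 ∑≡0 a = trans (F-per (≈-sym (residue-⟦⟧ a)))
    (∑-nonPositive-≡0 {p} (F ∘ residue) (λ x → F≤0 (residue x)) ∑≡0 ⟦ a ⟧)

  -- The indicator of divisibility by p

  δ : ℤ → ℤ
  δ a = indicator (+ p ∣? a)

  δ-periodic : Periodic δ
  δ-periodic {a} {b} a≈b = indicator-cong (+ p ∣? a) (+ p ∣? b) (∣-resp-≈ a≈b) (∣-resp-≈ (≈-sym a≈b))

  δ-yes : ∀ {a} → + p ∣ a → δ a ≡ 1ℤ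
  δ-yes {a} = indicator-yes (+ p ∣? a)

  δ-no : ∀ {a} → ¬ + p ∣ a → δ a ≡ 0ℤ
  δ-no {a} = indicator-no (+ p ∣? a)

  δ-cong : ∀ {a b} → (+ p ∣ a → + p ∣ b) → (+ p ∣ b → + p ∣ a) → δ a ≡ δ b
  δ-cong {a} {b} = indicator-cong (+ p ∣? a) (+ p ∣? b)

  -- Primality makes the zero set of a product the union of the zero sets of its factors; the
  -- hypothesis makes this union disjoint. Root counts of factored polynomials rest on this.
  δ-* : ∀ a b → ¬ (+ p ∣ a × + p ∣ b) → δ (a * b) ≡ δ a + δ b
  δ-* a b coprime with + p ∣? a | + p ∣? b
  ... | yes d | yes e = contradiction (d , e) coprime
  ... | yes d | no _  = δ-yes (∣m⇒∣m*n b d)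
  ... | no _  | yes e = δ-yes (∣n⇒∣m*n a e)
  ... | no ¬d | no ¬e = δ-no ([ ¬d , ¬e ]′ ∘ prime-∣ a b)

  ∑ₚ-δ* : ∀ {F} → Periodic F → ∀ a → ∑ₚ (λ b → δ (b - a) * F b) ≡ F a
  ∑ₚ-δ* {F} F-per a = begin
    ∑ₚ (λ b → δ (b - a) * F b)                ≡⟨ ∑-single {p} (λ x → δ (residue x - a) * F (residue x)) ⟦ a ⟧ off ⟩
    δ (residue ⟦ a ⟧ - a) * F (residue ⟦ a ⟧) ≡⟨ cong₂ _*_ (δ-yes (divides-difference (residue-⟦⟧ a)))
                                                          (F-per (residue-⟦⟧ a)) ⟩
    1ℤ * F a                                  ≡⟨ ℤ.*-identityˡ (F a) ⟩
    F a                                       ∎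
    where
    open ≡-Reasoning
    off : ∀ x → x ≢ ⟦ a ⟧ → δ (residue x - a) * F (residue x) ≡ 0ℤ
    off x x≢ = trans (cong (_* F (residue x)) (δ-no λ d → x≢
      (residue-injective (≈-trans (mod d) (≈-sym (residue-⟦⟧ a))))))
      (ℤ.*-zeroˡ (F (residue x)))

  ∑ₚ-δ : ∀ a → ∑ₚ (λ b → δ (b - a)) ≡ 1ℤ
  ∑ₚ-δ a = trans (∑ₚ-cong (λ b → sym (ℤ.*-identityʳ (δ (b - a))))) (∑ₚ-δ* {λ _ → 1ℤ} (λ _ → refl) a)

  ∑ₚ-δ₀ : ∑ₚ δ ≡ 1ℤ
  ∑ₚ-δ₀ = trans (∑ₚ-cong (λ b → cong δ (sym (ℤ.+-identityʳ b)))) (∑ₚ-δ 0ℤ)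

module LegendreSums (p : ℕ) (p-prime : Prime p) (3<p : 3 < p) where

  open Residues p p-prime
  open ≡-Reasoning

  p∤ : ∀ n .{{_ : NonZero n}} → n < p → ¬ + p ∣ + n
  p∤ n n<p = ℕ.>⇒∤ n<p ∘ ∣⇒∣ᵤ

  p∤1 : ¬ + p ∣ 1ℤ
  p∤1 = p∤ 1 (ℕ.<-trans (ℕ.s<s ℕ.z<s) 3<p)

  p∤2 : ¬ + p ∣ + 2
  p∤2 = p∤ 2 (ℕ.<-trans (ℕ.n<1+n 2) 3<p)

  p∤3 : ¬ + p ∣ + 3
  p∤3 = p∤ 3 3<p

  -- The Legendre symbol

  χ : ℤ → ℤ
  χ a = legendre a p

  -- A specification of the symbol indexed by its value, so that matching on `legendreCase a`
  -- together with `χ a` fixes the value. Square roots range over all integers, which frees later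
  -- arguments from reducing them.
  data LegendreCase (a : ℤ) : ℤ → Set where
    divisible : + p ∣ a → LegendreCase a 0ℤ
    square    : ¬ + p ∣ a → ∀ s → a ≈ s * s → LegendreCase a 1ℤ
    nonsquare : ¬ + p ∣ a → (∀ s → ¬ a ≈ s * s) → LegendreCase a -1ℤ

  legendreCase : ∀ a → LegendreCase a (χ a)
  legendreCase a with + p ∣? a | isSquareMod? p a
  ... | yes p∣a | _            = divisible p∣a
  -- `residue y ^ 2` unfolds to a product ending in a factor 1, which is removed here and reinserted
  -- in the nonsquare case.
  ... | no  p∤a | yes (y , d)  = square p∤a (residue y) (≈-sym (mod
    (subst (λ z → + p ∣ z - a) (cong (residue y *_) (ℤ.*-identityʳ (residue y))) d)))
  ... | no  p∤a | no ¬sq       = nonsquare p∤a λ s a≈s² → ¬sq (⟦ s ⟧ ,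
    subst (λ z → + p ∣ z - a) (cong (residue ⟦ s ⟧ *_) (sym (ℤ.*-identityʳ (residue ⟦ s ⟧))))
      (_≈_.divides-difference
        (≈-trans (*-cong (residue-⟦⟧ s) (residue-⟦⟧ s)) (≈-sym a≈s²))))

  -- The three cases exclude one another, so exhibiting any one of them evaluates `χ`; this is how
  -- `χ-≡` is used throughout.
  legendreCase-unique : ∀ {a u v} → LegendreCase a u → LegendreCase a v → u ≡ v
  legendreCase-unique (divisible d)     (divisible _)     = refl
  legendreCase-unique (divisible d)     (square e _ _)    = contradiction d e
  legendreCase-unique (divisible d)     (nonsquare e _)   = contradiction d e
  legendreCase-unique (square d _ _)    (divisible e)     = contradiction e d
  legendreCase-unique (square _ _ _)    (square _ _ _)    = refl
  legendreCase-unique (square _ s d)    (nonsquare _ e)   = contradiction d (e s)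
  legendreCase-unique (nonsquare d _)   (divisible e)     = contradiction e d
  legendreCase-unique (nonsquare _ d)   (square _ s e)    = contradiction e (d s)
  legendreCase-unique (nonsquare _ _)   (nonsquare _ _)   = refl

  legendreCase-resp-≈ : ∀ {a b u} → a ≈ b → LegendreCase a u → LegendreCase b u
  legendreCase-resp-≈ a≈b (divisible d)   = divisible (∣-resp-≈ a≈b d)
  legendreCase-resp-≈ a≈b (square d s e)  =
    square (d ∘ ∣-resp-≈ (≈-sym a≈b)) s (≈-trans (≈-sym a≈b) e)
  legendreCase-resp-≈ a≈b (nonsquare d e) =
    nonsquare (d ∘ ∣-resp-≈ (≈-sym a≈b)) (λ s → e s ∘ ≈-trans a≈b)

  χ-≡ : ∀ {a u} → LegendreCase a u → χ a ≡ u
  χ-≡ = legendreCase-unique (legendreCase _)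

  χ-periodic : Periodic χ
  χ-periodic {a} a≈b = sym (χ-≡ (legendreCase-resp-≈ a≈b (legendreCase a)))

  χ≤1 : ∀ a → χ a ℤ.≤ 1ℤ
  χ≤1 a with χ a | legendreCase a
  ... | _ | divisible _   = ℤ.+≤+ ℕ.z≤n
  ... | _ | square _ _ _  = ℤ.≤-refl
  ... | _ | nonsquare _ _ = ℤ.-≤+

  χ-1 : χ 1ℤ ≡ 1ℤ
  χ-1 = χ-≡ (square p∤1 1ℤ ≈-refl)

  χ² : ∀ a → χ a * χ a ≡ 1ℤ - δ a
  χ² a with χ a | legendreCase a
  ... | _ | divisible d   rewrite δ-yes d = refl
  ... | _ | square d _ _  rewrite δ-no d = refl
  ... | _ | nonsquare d _ rewrite δ-no d = refl

  -- The sum counts the square roots of `b`: only 0 if `p` divides `b`, the two classes of `s` and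
  -- `- s` if `b ≈ s * s` is a unit, and none otherwise.
  ∑ₚ-square-roots : ∀ b → ∑ₚ (λ t → δ (b - t * t)) ≡ 1ℤ + χ b
  ∑ₚ-square-roots b with χ b | legendreCase b
  ... | _ | divisible d = trans
    (∑ₚ-cong (λ t → δ-cong {b - t * t} {t}
      (λ e → square-∣ t (∣-combine 1ℤ -1ℤ d e (solve (b ∷ t ∷ []))))
      (λ e → ∣-combine 1ℤ (- t) d e (solve (b ∷ t ∷ [])))))
    ∑ₚ-δ₀
  ... | _ | square d s e = begin
    ∑ₚ (λ t → δ (b - t * t))             ≡⟨ ∑ₚ-cong factor ⟩
    ∑ₚ (λ t → δ (t - s) + δ (t - - s))   ≡⟨ ∑ₚ-+ (λ t → δ (t - s)) (λ t → δ (t - - s)) ⟩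
    ∑ₚ (λ t → δ (t - s)) + ∑ₚ (λ t → δ (t - - s)) ≡⟨ cong₂ _+_ (∑ₚ-δ s) (∑ₚ-δ (- s)) ⟩
    1ℤ + 1ℤ                              ∎
    where
    p∤s : ¬ + p ∣ s
    p∤s f = d (∣-resp-≈ (≈-sym e) (∣n⇒∣m*n s f))
    factor : ∀ t → δ (b - t * t) ≡ δ (t - s) + δ (t - - s)
    factor t = trans
      (δ-cong {b - t * t} {(t - s) * (t - - s)}
        (λ f → ∣-combine 1ℤ -1ℤ (_≈_.divides-difference e) f (solve (b ∷ s ∷ t ∷ [])))
        (λ f → ∣-combine 1ℤ -1ℤ (_≈_.divides-difference e) f (solve (b ∷ s ∷ t ∷ []))))
      -- The two roots are distinct: the difference of the factors is `2s`, a unit because `p` is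
      -- odd and does not divide `s`.
      (δ-* (t - s) (t - - s) λ (f , g) →
        p∤s (*-cancel-∣ s p∤2 (∣-combine -1ℤ 1ℤ f g (solve (s ∷ t ∷ [])))))
  ... | _ | nonsquare d e = ∑ₚ-zero (λ t → δ (b - t * t)) (λ t → δ-no (e t ∘ mod))

  -- Sorting the `t` by the class `b` of their square, through an inserted `δ (b - t * t)`, gives
  -- each `b` its number of square roots as weight.
  ∑ₚ-squares : ∀ {F} → Periodic F → ∑ₚ (λ t → F (t * t)) ≡ ∑ₚ (λ b → (1ℤ + χ b) * F b)
  ∑ₚ-squares {F} F-per = begin
    ∑ₚ (λ t → F (t * t))                        ≡⟨ ∑ₚ-cong (λ t → ∑ₚ-δ* F-per (t * t)) ⟨
    ∑ₚ (λ t → ∑ₚ (λ b → δ (b - t * t) * F b))   ≡⟨ ∑ₚ-comm (λ t b → δ (b - t * t) * F b) ⟩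
    ∑ₚ (λ b → ∑ₚ (λ t → δ (b - t * t) * F b))   ≡⟨ ∑ₚ-cong (λ b → ∑ₚ-*ʳ (F b) (λ t → δ (b - t * t))) ⟩
    ∑ₚ (λ b → ∑ₚ (λ t → δ (b - t * t)) * F b)   ≡⟨ ∑ₚ-cong (λ b → cong (_* F b) (∑ₚ-square-roots b)) ⟩
    ∑ₚ (λ b → (1ℤ + χ b) * F b)                 ∎

  -- This is `∑ₚ-squares` for the constant function 1: counting all `t` by their squares gives
  -- `p = p + ∑ χ`.
  ∑ₚ-χ : ∑ₚ χ ≡ 0ℤ
  ∑ₚ-χ = identityʳ-unique (∑ₚ (λ _ → 1ℤ)) (∑ₚ χ) (begin
    ∑ₚ (λ _ → 1ℤ) + ∑ₚ χ            ≡⟨ ∑ₚ-+ (λ _ → 1ℤ) χ ⟨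
    ∑ₚ (λ b → 1ℤ + χ b)             ≡⟨ ∑ₚ-cong (λ b → ℤ.*-identityʳ (1ℤ + χ b)) ⟨
    ∑ₚ (λ b → (1ℤ + χ b) * 1ℤ)      ≡⟨ ∑ₚ-squares {λ _ → 1ℤ} (λ _ → refl) ⟨
    ∑ₚ (λ _ → 1ℤ)                   ∎)

  -- Roots of `b` and of `s * s * b` correspond under multiplication by `s`; the way back uses an
  -- inverse of `s`.
  χ-square-* : ∀ {a s} b → ¬ + p ∣ s → a ≈ s * s → χ (a * b) ≡ χ b
  χ-square-* {a} {s} b p∤s a≈s² = χ-≡
    (legendreCase-resp-≈ (*-cong (≈-sym a≈s²) ≈-refl) (times b (legendreCase b)))
    where
    p∤s²b : ∀ {b} → ¬ + p ∣ b → ¬ + p ∣ s * s * b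
    p∤s²b {b} p∤b d = p∤b (*-cancel-∣ b p∤s (*-cancel-∣ (s * b) p∤s (subst (+ p ∣_) (ℤ.*-assoc s s b) d)))
    times : ∀ {u} b → LegendreCase b u → LegendreCase (s * s * b) u
    times b (divisible d)   = divisible (∣n⇒∣m*n (s * s) d)
    times b (square d r e)  = square (p∤s²b d) (s * r)
      (≈-trans (*-cong (≈-refl {s * s}) e) (≈-reflexive (solve (s ∷ r ∷ []))))
    times b (nonsquare d e) = nonsquare (p∤s²b d) λ r s²b≈r² →
      e (r * proj₁ (inverse s p∤s)) (divide r s²b≈r² (inverse s p∤s))
      where
      divide : ∀ r → s * s * b ≈ r * r → ((t , _) : ∃[ t ] s * t ≈ 1ℤ) → b ≈ (r * t) * (r * t)
      divide r (mod f) (t , mod g) = mod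
        -- With `st ≡ 1`: `b - (rt)² = t²(s²b - r²) - b(st + 1)(st - 1)`.
        (∣-combine (t * t) (- b * (s * t + 1ℤ)) f g (solve (s ∷ t ∷ b ∷ r ∷ [])))

  -- For a nonsquare a every term of ∑ (χ(ab) + χ(b)) is nonpositive, while the sum vanishes.
  χ-* : ∀ a b → χ (a * b) ≡ χ a * χ b
  χ-* a b with χ a | legendreCase a
  ... | _ | divisible d  = trans (χ-≡ (divisible (∣m⇒∣m*n b d))) (sym (ℤ.*-zeroˡ (χ b)))
  ... | _ | square d s e = trans (χ-square-* b p∤s e) (sym (ℤ.*-identityˡ (χ b)))
    where
    p∤s : ¬ + p ∣ s
    p∤s f = d (∣-resp-≈ (≈-sym e) (∣n⇒∣m*n s f))
  ... | _ | nonsquare d e = trans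
    (inverseˡ-unique (χ (a * b)) (χ b) (∑ₚ-nonPositive-≡0 F-per F≤0 ∑F≡0 b))
    (sym (ℤ.-1*i≡-i (χ b)))
    where
    F : ℤ → ℤ
    F b = χ (a * b) + χ b
    F-per : Periodic F
    F-per b≈c = cong₂ _+_ (χ-periodic (*-cong (≈-refl {a}) b≈c)) (χ-periodic b≈c)
    F≤0 : ∀ b → F b ℤ.≤ 0ℤ
    F≤0 b with χ b | legendreCase b
    ... | _ | divisible f   = ℤ.≤-reflexive (trans (ℤ.+-identityʳ _) (χ-≡ (divisible (∣n⇒∣m*n a f))))
    ... | _ | square f s g  = ℤ.≤-reflexive (cong (_+ 1ℤ) (begin
      χ (a * b) ≡⟨ cong χ (ℤ.*-comm a b) ⟩
      χ (b * a) ≡⟨ χ-square-* a (λ h → f (∣-resp-≈ (≈-sym g) (∣n⇒∣m*n s h))) g ⟩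
      χ a       ≡⟨ χ-≡ (nonsquare d e) ⟩
      -1ℤ       ∎))
    ... | _ | nonsquare _ _ = ℤ.+-monoˡ-≤ -1ℤ (χ≤1 (a * b))
    ∑F≡0 : ∑ₚ F ≡ 0ℤ
    ∑F≡0 = trans (∑ₚ-+ (λ b → χ (a * b)) χ) (cong₂ _+_ (trans (∑ₚ-scale χ-periodic a d) ∑ₚ-χ) ∑ₚ-χ)

  -- Without a nonresidue every `- χ a` would be nonpositive. As these values sum to 0, all would
  -- vanish, against `χ 1ℤ ≡ 1ℤ`.
  nonresidue : ∃[ d ] χ d ≡ -1ℤ
  nonresidue with Fin.any? (λ (x : Fin p) → χ (residue x) ℤ.≟ -1ℤ)
  ... | yes (x , eq) = residue x , eq
  ... | no none      = contradiction
    (trans (cong -_ (sym χ-1)) (∑ₚ-nonPositive-≡0 (λ a≈b → cong -_ (χ-periodic a≈b)) -χ≤0 ∑≡0 1ℤ)) λ ()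
    where
    -χ≤0 : ∀ a → - χ a ℤ.≤ 0ℤ
    -χ≤0 a with χ a in eq | legendreCase a
    ... | _ | divisible _   = ℤ.≤-refl
    ... | _ | square _ _ _  = ℤ.-≤+
    ... | _ | nonsquare _ _ = contradiction (⟦ a ⟧ , trans (χ-periodic (residue-⟦⟧ a)) eq) none
    ∑≡0 : ∑ₚ (λ a → - χ a) ≡ 0ℤ
    ∑≡0 = begin
      ∑ₚ (λ a → - χ a)       ≡⟨ ∑ₚ-cong (λ a → ℤ.-1*i≡-i (χ a)) ⟨
      ∑ₚ (λ a → -1ℤ * χ a)   ≡⟨ ∑ₚ-*ˡ -1ℤ χ ⟩
      -1ℤ * ∑ₚ χ             ≡⟨ cong (-1ℤ *_) ∑ₚ-χ ⟩
      0ℤ                     ∎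

  -- Correlation of the Legendre symbol with its translates

  correlation : ℤ → ℤ
  correlation c = ∑ₚ (λ b → χ b * χ (b + c))

  correlation-periodic : Periodic correlation
  correlation-periodic c≈d = ∑ₚ-cong (λ b → cong (χ b *_) (χ-periodic (+-cong (≈-refl {b}) c≈d)))

  correlation-0 : correlation 0ℤ ≡ + p - 1ℤ
  correlation-0 = begin
    ∑ₚ (λ b → χ b * χ (b + 0ℤ))    ≡⟨ ∑ₚ-cong (λ b → cong (λ c → χ b * χ c) (ℤ.+-identityʳ b)) ⟩
    ∑ₚ (λ b → χ b * χ b)           ≡⟨ ∑ₚ-cong (λ b → trans (χ² b) (cong (_+_ 1ℤ) (sym (ℤ.-1*i≡-i (δ b))))) ⟩
    ∑ₚ (λ b → 1ℤ + -1ℤ * δ b)      ≡⟨ ∑ₚ-+ (λ _ → 1ℤ) (λ b → -1ℤ * δ b) ⟩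
    ∑ₚ (λ _ → 1ℤ) + ∑ₚ (λ b → -1ℤ * δ b)
      ≡⟨ cong₂ _+_ (trans (∑ₚ-const 1ℤ) (ℤ.*-identityʳ (+ p))) (trans (∑ₚ-*ˡ -1ℤ δ) (cong (-1ℤ *_) ∑ₚ-δ₀)) ⟩
    + p - 1ℤ                       ∎

  -- Replacing `b` by `c * b` extracts a factor `χ c` from each symbol, and `χ c * χ c` is 1.
  correlation-scale : ∀ c → ¬ + p ∣ c → correlation c ≡ correlation 1ℤ
  correlation-scale c p∤c = begin
    ∑ₚ (λ b → χ b * χ (b + c))
      ≡⟨ ∑ₚ-scale (λ a≈b → cong₂ _*_ (χ-periodic a≈b) (χ-periodic (+-cong a≈b ≈-refl))) c p∤c ⟨
    ∑ₚ (λ b → χ (c * b) * χ (c * b + c))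
      ≡⟨ ∑ₚ-cong (λ b → cong₂ _*_ (χ-* c b) (trans (cong χ (factor c b)) (χ-* c (b + 1ℤ)))) ⟩
    ∑ₚ (λ b → (χ c * χ b) * (χ c * χ (b + 1ℤ)))
      ≡⟨ ∑ₚ-cong (λ b → trans (swap (χ c) (χ b) (χ (b + 1ℤ)))
           (trans (cong (_* (χ b * χ (b + 1ℤ))) (trans (χ² c) (cong (_-_ 1ℤ) (δ-no p∤c)))) (ℤ.*-identityˡ _))) ⟩
    ∑ₚ (λ b → χ b * χ (b + 1ℤ)) ∎
    where
    factor : ∀ c b → c * b + c ≡ c * (b + 1ℤ)
    factor = solve-∀
    swap : ∀ c x y → (c * x) * (c * y) ≡ (c * c) * (x * y)
    swap = solve-∀

  -- Once the order of summation is exchanged, the inner sum is a translate of the full character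
  -- sum, which vanishes.
  ∑ₚ-correlation : ∑ₚ correlation ≡ 0ℤ
  ∑ₚ-correlation = begin
    ∑ₚ (λ c → ∑ₚ (λ b → χ b * χ (b + c)))  ≡⟨ ∑ₚ-comm (λ c b → χ b * χ (b + c)) ⟩
    ∑ₚ (λ b → ∑ₚ (λ c → χ b * χ (b + c)))  ≡⟨ ∑ₚ-zero (λ b → ∑ₚ (λ c → χ b * χ (b + c))) (λ b → begin
      ∑ₚ (λ c → χ b * χ (b + c))             ≡⟨ ∑ₚ-*ˡ (χ b) (λ c → χ (b + c)) ⟩
      χ b * ∑ₚ (λ c → χ (b + c))             ≡⟨ cong (χ b *_) (∑ₚ-cong (λ c → cong χ (ℤ.+-comm b c))) ⟩
      χ b * ∑ₚ (λ c → χ (c + b))             ≡⟨ cong (χ b *_) (trans (∑ₚ-shift χ-periodic b) ∑ₚ-χ) ⟩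
      χ b * 0ℤ                               ≡⟨ ℤ.*-zeroʳ (χ b) ⟩
      0ℤ                                     ∎) ⟩
    0ℤ                                     ∎

  -- There are only two values, one at 0 and one at all units. Writing them as an affine expression
  -- in `δ c` lets them be summed by linearity.
  correlation-split : ∀ c → correlation c ≡ correlation 1ℤ + (+ p - 1ℤ - correlation 1ℤ) * δ c
  correlation-split c with + p ∣? c
  ... | yes d = trans (trans (correlation-periodic (∣⇒≈0 d)) correlation-0) (reassemble (+ p - 1ℤ) (correlation 1ℤ))
    where
    reassemble : ∀ u v → u ≡ v + (u - v) * 1ℤ
    reassemble = solve-∀
  ... | no ¬d = trans (correlation-scale c ¬d) (reassemble (+ p - 1ℤ - correlation 1ℤ) (correlation 1ℤ))
    where
    reassemble : ∀ u v → v ≡ v + u * 0ℤ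
    reassemble = solve-∀

  -- The p - 1 equal values at c ≢ 0 and the value p - 1 at c = 0 add up to 0.
  correlation-1 : correlation 1ℤ ≡ -1ℤ
  correlation-1 = solve-for (+ p) (correlation 1ℤ) p-1≢0 (begin
    + p * correlation 1ℤ + (+ p - 1ℤ - correlation 1ℤ) * 1ℤ
      ≡⟨ cong₂ _+_ (sym (∑ₚ-const (correlation 1ℤ)))
           (trans (cong (k *_) (sym ∑ₚ-δ₀)) (sym (∑ₚ-*ˡ k δ))) ⟩
    ∑ₚ (λ _ → correlation 1ℤ) + ∑ₚ (λ c → k * δ c)
      ≡⟨ ∑ₚ-+ (λ _ → correlation 1ℤ) (λ c → k * δ c) ⟨
    ∑ₚ (λ c → correlation 1ℤ + k * δ c) ≡⟨ ∑ₚ-cong correlation-split ⟨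
    ∑ₚ correlation                      ≡⟨ ∑ₚ-correlation ⟩
    0ℤ                                  ∎)
    where
    k = + p - 1ℤ - correlation 1ℤ
    p-1≢0 : + p - 1ℤ ≢ 0ℤ
    p-1≢0 eq = ℕ.<⇒≢ (ℕ.<-trans (ℕ.s<s ℕ.z<s) 3<p) (sym (ℤ.+-injective (ℤ.i-j≡0⇒i≡j (+ p) 1ℤ eq)))
    solve-for : ∀ q t → q - 1ℤ ≢ 0ℤ → q * t + (q - 1ℤ - t) * 1ℤ ≡ 0ℤ → t ≡ -1ℤ
    solve-for q t q-1≢0 eq with ℤ.i*j≡0⇒i≡0∨j≡0 (q - 1ℤ) (trans (factor q t) eq)
      where
      factor : ∀ q t → (q - 1ℤ) * (t - -1ℤ) ≡ q * t + (q - 1ℤ - t) * 1ℤ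
      factor = solve-∀
    ... | inj₁ q-1≡0 = contradiction q-1≡0 q-1≢0
    ... | inj₂ t+1≡0 = ℤ.i-j≡0⇒i≡j t -1ℤ t+1≡0

  correlation-≡ : ∀ c → correlation c ≡ + p * δ c - 1ℤ
  correlation-≡ c = begin
    correlation c                                    ≡⟨ correlation-split c ⟩
    correlation 1ℤ + (+ p - 1ℤ - correlation 1ℤ) * δ c
      ≡⟨ cong (λ t → t + (+ p - 1ℤ - t) * δ c) correlation-1 ⟩
    -1ℤ + (+ p - 1ℤ - -1ℤ) * δ c                     ≡⟨ simplify (+ p) (δ c) ⟩
    + p * δ c - 1ℤ                                   ∎
    where
    simplify : ∀ q d → -1ℤ + (q - 1ℤ - -1ℤ) * d ≡ q * d - 1ℤ
    simplify = solve-∀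

  -- Cubic character sums

  S : ℤ → ℤ
  S b = ∑ₚ (λ x → χ (x * x * x + b))

  S²-periodic : Periodic (λ b → S b * S b)
  S²-periodic b≈c = cong₂ _*_ S-b≡S-c S-b≡S-c
    where
    S-b≡S-c = ∑ₚ-cong (λ x → χ-periodic (+-cong (≈-refl {x * x * x}) b≈c))

  χ-cube-nonresidue : ∀ {d} → χ d ≡ -1ℤ → χ (d * d * d) ≡ -1ℤ
  χ-cube-nonresidue {d} χd≡-1 = begin
    χ (d * d * d)     ≡⟨ trans (χ-* (d * d) d) (cong (_* χ d) (χ-* d d)) ⟩
    χ d * χ d * χ d   ≡⟨ cong (λ u → u * u * u) χd≡-1 ⟩
    -1ℤ               ∎

  -- Substituting `d * x` for `x` makes `d³` a common factor of the argument, and `χ (d³)` is -1.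
  S-twist : ∀ {d} → χ d ≡ -1ℤ → ∀ b → S (d * d * d * b) ≡ - S b
  S-twist {d} χd≡-1 b = begin
    ∑ₚ (λ x → χ (x * x * x + d * d * d * b))
      ≡⟨ ∑ₚ-scale (λ x≈y → χ-periodic (+-cong (*-cong (*-cong x≈y x≈y) x≈y) ≈-refl)) d p∤d ⟨
    ∑ₚ (λ x → χ (d * x * (d * x) * (d * x) + d * d * d * b))
      ≡⟨ ∑ₚ-cong (λ x → trans (cong χ (factor d x b)) (χ-d³ (x * x * x + b))) ⟩
    ∑ₚ (λ x → -1ℤ * χ (x * x * x + b))
      ≡⟨ ∑ₚ-*ˡ -1ℤ (λ x → χ (x * x * x + b)) ⟩
    -1ℤ * S b
      ≡⟨ ℤ.-1*i≡-i (S b) ⟩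
    - S b ∎
    where
    p∤d : ¬ + p ∣ d
    p∤d f = contradiction (trans (sym χd≡-1) (χ-≡ (divisible f))) λ ()
    factor : ∀ d x b → d * x * (d * x) * (d * x) + d * d * d * b ≡ d * d * d * (x * x * x + b)
    factor = solve-∀
    χ-d³ : ∀ a → χ (d * d * d * a) ≡ -1ℤ * χ a
    χ-d³ a = trans (χ-* (d * d * d) a) (cong (_* χ a) (χ-cube-nonresidue χd≡-1))

  -- Twisting by a nonresidue d preserves S² and reverses the sign of χ.
  ∑ₚ-χS² : ∑ₚ (λ b → χ b * (S b * S b)) ≡ 0ℤ
  ∑ₚ-χS² = self-negative (begin
    ∑ₚ (λ b → χ b * (S b * S b))
      ≡⟨ ∑ₚ-scale (λ b≈c → cong₂ _*_ (χ-periodic b≈c) (S²-periodic b≈c)) (d * d * d) p∤d³ ⟨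
    ∑ₚ (λ b → χ (d * d * d * b) * (S (d * d * d * b) * S (d * d * d * b)))
      ≡⟨ ∑ₚ-cong (λ b → cong₂ (λ u v → u * (v * v)) (χ-* (d * d * d) b) (S-twist χd≡-1 b)) ⟩
    ∑ₚ (λ b → χ (d * d * d) * χ b * (- S b * - S b))
      ≡⟨ ∑ₚ-cong (λ b → trans (cong (λ u → u * χ b * (- S b * - S b)) χd³) (sign (χ b) (S b))) ⟩
    ∑ₚ (λ b → -1ℤ * (χ b * (S b * S b)))
      ≡⟨ ∑ₚ-*ˡ -1ℤ (λ b → χ b * (S b * S b)) ⟩
    -1ℤ * ∑ₚ (λ b → χ b * (S b * S b)) ∎)
    where
    d = proj₁ nonresidue
    χd≡-1 = proj₂ nonresidue
    χd³ = χ-cube-nonresidue χd≡-1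
    p∤d³ : ¬ + p ∣ d * d * d
    p∤d³ f = contradiction (trans (sym χd³) (χ-≡ (divisible f))) λ ()
    sign : ∀ u v → -1ℤ * u * (- v * - v) ≡ -1ℤ * (u * (v * v))
    sign = solve-∀
    self-negative : ∀ {x} → x ≡ -1ℤ * x → x ≡ 0ℤ
    self-negative {x} eq = [ (λ ()) , (λ x≡0 → x≡0) ]′ (ℤ.i*j≡0⇒i≡0∨j≡0 (+ 2) (begin
      + 2 * x        ≡⟨ double x ⟩
      x - -1ℤ * x    ≡⟨ ℤ.i≡j⇒i-j≡0 eq ⟩
      0ℤ             ∎))
      where
      double : ∀ x → + 2 * x ≡ x - -1ℤ * x
      double = solve-∀

  -- The number of `y` modulo `p` with the same cube as `x`; its sum over `x` is the count N of
  -- pairs.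
  equalCubes : ℤ → ℤ
  equalCubes x = ∑ₚ (λ y → δ (y * y * y - x * x * x))

  -- The square is expanded into a triple sum and the sum over `b` moved innermost, where it becomes
  -- a correlation at `y³ - x³`.
  ∑ₚ-S² : ∑ₚ (λ b → S b * S b) ≡ + p * ∑ₚ equalCubes - + p * + p
  ∑ₚ-S² = begin
    ∑ₚ (λ b → S b * S b)
      ≡⟨ ∑ₚ-cong (λ b → trans (sym (∑ₚ-*ʳ (S b) (λ x → χ (x * x * x + b))))
           (∑ₚ-cong (λ x → sym (∑ₚ-*ˡ (χ (x * x * x + b)) (λ y → χ (y * y * y + b)))))) ⟩
    ∑ₚ (λ b → ∑ₚ (λ x → ∑ₚ (λ y → term b x y)))
      ≡⟨ ∑ₚ-comm (λ b x → ∑ₚ (λ y → term b x y)) ⟩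
    ∑ₚ (λ x → ∑ₚ (λ b → ∑ₚ (λ y → term b x y)))
      ≡⟨ ∑ₚ-cong (λ x → ∑ₚ-comm (λ b y → term b x y)) ⟩
    ∑ₚ (λ x → ∑ₚ (λ y → ∑ₚ (λ b → term b x y)))
      ≡⟨ ∑ₚ-cong (λ x → ∑ₚ-cong (λ y → trans (inner x y) (correlation-≡ (y * y * y - x * x * x)))) ⟩
    ∑ₚ (λ x → ∑ₚ (λ y → + p * δ (y * y * y - x * x * x) - 1ℤ))
      ≡⟨ ∑ₚ-cong (λ x → affine (λ y → δ (y * y * y - x * x * x)) -1ℤ) ⟩
    ∑ₚ (λ x → + p * equalCubes x + + p * -1ℤ)
      ≡⟨ affine equalCubes (+ p * -1ℤ) ⟩
    + p * ∑ₚ equalCubes + + p * (+ p * -1ℤ)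
      ≡⟨ rearrange (+ p) (∑ₚ equalCubes) ⟩
    + p * ∑ₚ equalCubes - + p * + p ∎
    where
    term : ℤ → ℤ → ℤ → ℤ
    term b x y = χ (x * x * x + b) * χ (y * y * y + b)
    affine : ∀ F c → ∑ₚ (λ y → + p * F y + c) ≡ + p * ∑ₚ F + + p * c
    affine F c = trans (∑ₚ-+ (λ y → + p * F y) (λ _ → c)) (cong₂ _+_ (∑ₚ-*ˡ (+ p) F) (∑ₚ-const c))
    rearrange : ∀ q n → q * n + q * (q * -1ℤ) ≡ q * n - q * q
    rearrange = solve-∀
    shift : ∀ b u v → v + b ≡ b + u + (v - u)
    shift = solve-∀
    inner : ∀ x y → ∑ₚ (λ b → term b x y) ≡ correlation (y * y * y - x * x * x)
    -- The variable `b + x³` replaces `b`.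
    inner x y = trans
      (∑ₚ-cong (λ b → cong₂ (λ u v → χ u * χ v) (ℤ.+-comm (x * x * x) b) (shift b (x * x * x) (y * y * y))))
      (∑ₚ-shift {λ a → χ a * χ (a + (y * y * y - x * x * x))}
        (λ a≈b → cong₂ _*_ (χ-periodic a≈b) (χ-periodic (+-cong a≈b ≈-refl))) (x * x * x))

  A₂-≡ : A₂ p ≡ + p * ∑ₚ equalCubes - + p * + p
  A₂-≡ = begin
    A₂ p                                                ≡⟨ sum-cong-≗ {p} aₜ² ⟩
    ∑ₚ (λ t → S (t * t) * S (t * t))                    ≡⟨ ∑ₚ-squares S²-periodic ⟩
    ∑ₚ (λ b → (1ℤ + χ b) * (S b * S b))
      ≡⟨ ∑ₚ-cong (λ b → distrib (χ b) (S b * S b)) ⟩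
    ∑ₚ (λ b → S b * S b + χ b * (S b * S b))
      ≡⟨ ∑ₚ-+ (λ b → S b * S b) (λ b → χ b * (S b * S b)) ⟩
    ∑ₚ (λ b → S b * S b) + ∑ₚ (λ b → χ b * (S b * S b)) ≡⟨ cong₂ _+_ ∑ₚ-S² ∑ₚ-χS² ⟩
    + p * ∑ₚ equalCubes - + p * + p + 0ℤ                ≡⟨ ℤ.+-identityʳ _ ⟩
    + p * ∑ₚ equalCubes - + p * + p                     ∎
    where
    distrib : ∀ u v → (1ℤ + u) * v ≡ v + u * v
    distrib = solve-∀
    powers : ∀ x t → x * (x * (x * 1ℤ)) + t * (t * 1ℤ) ≡ x * x * x + t * t
    powers = solve-∀
    square-neg : ∀ s → - s * (- s * 1ℤ) ≡ s * s
    square-neg = solve-∀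
    aₜ² : ∀ t → aₜ p t ^ 2 ≡ S (residue t * residue t) * S (residue t * residue t)
    aₜ² t = trans (square-neg (∑ₚ (λ x → χ (x ^ 3 + residue t ^ 2)))) (cong (λ s → s * s)
      (∑ₚ-cong (λ x → cong χ (powers x (residue t)))))

  -- Cube roots of unity

  -- Primitive roots only: since `p` exceeds 3, the class of 1 does not satisfy this equation.
  CubeRootOfUnity : ℤ → Set
  CubeRootOfUnity w = + p ∣ w * w + w + 1ℤ

  module WithCubeRoot (w : ℤ) (w-root : CubeRootOfUnity w) where

    w≢1 : ¬ + p ∣ w - 1ℤ
    -- Division by `w - 1` leaves remainder 3: `w² + w + 1 = (w + 2)(w - 1) + 3`.
    w≢1 d = p∤3 (∣-combine 1ℤ (- (w + + 2)) w-root d (solve (w ∷ [])))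

    p∤w : ¬ + p ∣ w
    p∤w d = p∤1 (∣-combine 1ℤ (- (w + 1ℤ)) w-root d (solve (w ∷ [])))

    p≡1+3M : ∃[ M ] + p ≡ 1ℤ + + 3 * M
    p≡1+3M = let M , eq = fixedPoints-order3 f f³≡id in M , trans eq (cong (_+ + 3 * M) fixed)
      where
      f : Fin p → Fin p
      f x = ⟦ w * residue x ⟧
      step : ∀ x → residue (f x) ≈ w * residue x
      step x = residue-⟦⟧ (w * residue x)
      f³≡id : ∀ x → f (f (f x)) ≡ x
      f³≡id x = residue-injective (≈-trans (step (f (f x))) (≈-trans (*-cong (≈-refl {w})
        (≈-trans (step (f x)) (*-cong (≈-refl {w}) (step x)))) (w³≈1 (residue x))))
        where
        w³≈1 : ∀ x → w * (w * (w * x)) ≈ x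
        -- `w³ - 1 = (w - 1)(w² + w + 1)`.
        w³≈1 x = mod (∣-multiple ((w - 1ℤ) * x) w-root (solve (w ∷ x ∷ [])))
      fixed : ∑[ x < p ] indicator (f x Fin.≟ x) ≡ 1ℤ
      fixed = trans (sum-cong-≗ {p} (λ x → indicator-cong (f x Fin.≟ x) (+ p ∣? residue x)
        (λ fx≡x → fixed⇒0 (residue x) (≈-trans (≈-sym (step x)) (≈-reflexive (cong residue fx≡x))))
        (λ d → residue-injective (≈-trans (step x) (0⇒fixed (residue x) d)))))
        ∑ₚ-δ₀
        where
        fixed⇒0 : ∀ x → w * x ≈ x → + p ∣ x
        fixed⇒0 x (mod d) = *-cancel-∣ x w≢1 (∣-multiple 1ℤ d (solve (w ∷ x ∷ [])))
        0⇒fixed : ∀ x → + p ∣ x → w * x ≈ x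
        0⇒fixed x d = mod (∣-multiple (w - 1ℤ) d (solve (w ∷ x ∷ [])))

    equalCubes-0 : ∀ x → + p ∣ x → equalCubes x ≡ 1ℤ
    equalCubes-0 x d = trans
      (∑ₚ-cong (λ y → δ-cong {y * y * y - x * x * x} {y}
        (λ e → cube-∣ y (∣-combine 1ℤ (x * x) e d (solve (x ∷ y ∷ []))))
        (λ e → ∣-combine (- (x * x)) (y * y) d e (solve (x ∷ y ∷ [])))))
      ∑ₚ-δ₀
      where
      cube-∣ : ∀ y → + p ∣ y * y * y → + p ∣ y
      cube-∣ y = [ square-∣ y , (λ d → d) ]′ ∘ prime-∣ (y * y) y

    -- `y³ - x³` splits modulo `p` with roots `x`, `wx` and `w²x`. They are pairwise distinct
    -- because `w`, `w - 1` and `x` are units, so each contributes one solution.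
    equalCubes-≢0 : ∀ x → ¬ + p ∣ x → equalCubes x ≡ + 3
    equalCubes-≢0 x p∤x = begin
      ∑ₚ (λ y → δ (y * y * y - x * x * x))
        ≡⟨ ∑ₚ-cong (λ y → factor y) ⟩
      ∑ₚ (λ y → δ (y - x) + (δ (y - w * x) + δ (y - w * w * x)))
        ≡⟨ ∑ₚ-+ (λ y → δ (y - x)) (λ y → δ (y - w * x) + δ (y - w * w * x)) ⟩
      ∑ₚ (λ y → δ (y - x)) + ∑ₚ (λ y → δ (y - w * x) + δ (y - w * w * x))
        ≡⟨ cong₂ _+_ (∑ₚ-δ x) (∑ₚ-+ (λ y → δ (y - w * x)) (λ y → δ (y - w * w * x))) ⟩
      1ℤ + (∑ₚ (λ y → δ (y - w * x)) + ∑ₚ (λ y → δ (y - w * w * x)))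
        ≡⟨ cong (_+_ 1ℤ) (cong₂ _+_ (∑ₚ-δ (w * x)) (∑ₚ-δ (w * w * x))) ⟩
      + 3 ∎
      where
      [w-1]x≢0 : ¬ + p ∣ (w - 1ℤ) * x
      [w-1]x≢0 = p∤x ∘ *-cancel-∣ x w≢1
      w[w-1]x≢0 : ¬ + p ∣ w * ((w - 1ℤ) * x)
      w[w-1]x≢0 = [w-1]x≢0 ∘ *-cancel-∣ ((w - 1ℤ) * x) p∤w
      module _ (y : ℤ) where
        roots≈ : y * y * y - x * x * x ≈ (y - x) * ((y - w * x) * (y - w * w * x))
        roots≈ = mod (∣-multiple ((y - x) * (x * y - (w - 1ℤ) * x * x)) w-root (solve (w ∷ x ∷ y ∷ [])))
        x-apart : + p ∣ y - x → ¬ + p ∣ (y - w * x) * (y - w * w * x)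
        x-apart e = [ first , second ]′ ∘ prime-∣ (y - w * x) (y - w * w * x)
          where
          first : ¬ + p ∣ y - w * x
          first f = [w-1]x≢0 (∣-combine 1ℤ -1ℤ e f (solve (w ∷ x ∷ y ∷ [])))
          second : ¬ + p ∣ y - w * w * x
          -- The inner combination yields `wx - w³x`; adding `(w³ - 1)x`, a multiple of
          -- `w² + w + 1`, leaves `(w - 1)x`.
          second f = [w-1]x≢0 (∣-combine 1ℤ ((w - 1ℤ) * x) (∣-combine (- w) w e f refl) w-root
            (solve (w ∷ x ∷ y ∷ [])))
        wx-apart : + p ∣ y - w * x → ¬ + p ∣ y - w * w * x
        wx-apart e f = w[w-1]x≢0 (∣-combine 1ℤ -1ℤ e f (solve (w ∷ x ∷ y ∷ [])))
        factor : δ (y * y * y - x * x * x) ≡ δ (y - x) + (δ (y - w * x) + δ (y - w * w * x))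
        factor = begin
          δ (y * y * y - x * x * x)
            ≡⟨ δ-periodic roots≈ ⟩
          δ ((y - x) * ((y - w * x) * (y - w * w * x)))
            ≡⟨ δ-* (y - x) ((y - w * x) * (y - w * w * x)) (λ (e , f) → x-apart e f) ⟩
          δ (y - x) + δ ((y - w * x) * (y - w * w * x))
            ≡⟨ cong (_+_ (δ (y - x))) (δ-* (y - w * x) (y - w * w * x) (λ (e , f) → wx-apart e f)) ⟩
          δ (y - x) + (δ (y - w * x) + δ (y - w * w * x)) ∎

    equalCubes-≡ : ∀ x → equalCubes x ≡ + 3 + - + 2 * δ x
    equalCubes-≡ x with + p ∣? x
    ... | yes d = equalCubes-0 x d
    ... | no ¬d = equalCubes-≢0 x ¬d

    ∑ₚ-equalCubes : ∑ₚ equalCubes ≡ + 3 * + p - + 2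
    ∑ₚ-equalCubes = begin
      ∑ₚ equalCubes                        ≡⟨ ∑ₚ-cong equalCubes-≡ ⟩
      ∑ₚ (λ x → + 3 + - + 2 * δ x)         ≡⟨ ∑ₚ-+ (λ _ → + 3) (λ x → - + 2 * δ x) ⟩
      ∑ₚ (λ _ → + 3) + ∑ₚ (λ x → - + 2 * δ x)
        ≡⟨ cong₂ _+_ (trans (∑ₚ-const (+ 3)) (ℤ.*-comm (+ p) (+ 3)))
             (trans (∑ₚ-*ˡ (- + 2) δ) (cong (- + 2 *_) ∑ₚ-δ₀)) ⟩
      + 3 * + p - + 2                      ∎

  module WithoutCubeRoot (no-root : ∀ w → ¬ CubeRootOfUnity w) where

    -- In `y³ - x³ = (y - x)(y² + xy + x²)` a zero of the second factor with `x` a unit would make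
    -- `y / x` a primitive cube root of unity. If `p` divides `x`, it also divides `y`, and `y ≡ x`
    -- again.
    equalCubes-≡ : ∀ x → equalCubes x ≡ 1ℤ
    equalCubes-≡ x = trans
      (∑ₚ-cong (λ y → δ-cong {y * y * y - x * x * x} {y - x} (cube-injective y)
        (λ d → ∣-multiple (y * y + x * y + x * x) d (solve (x ∷ y ∷ [])))))
      (∑ₚ-δ x)
      where
      rescale : ∀ y → + p ∣ y * y + x * y + x * x → (∃[ u ] x * u ≈ 1ℤ) → ∃[ w ] CubeRootOfUnity w
      -- With `w = yu` and `xu ≡ 1`: `w² + w + 1 = u²(y² + xy + x²) - (yu + xu + 1)(xu - 1)`.
      rescale y d (u , mod e) = y * u , ∣-combine (u * u) (- (y * u + x * u + 1ℤ)) d e (solve (x ∷ y ∷ u ∷ []))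
      both-0 : ∀ y → + p ∣ y * y + x * y + x * x → + p ∣ x → + p ∣ y - x
      both-0 y d e = ∣-combine 1ℤ -1ℤ
        (square-∣ y (∣-combine 1ℤ (- (y + x)) d e (solve (x ∷ y ∷ [])))) e (solve (x ∷ y ∷ []))
      norm-∣ : ∀ y → + p ∣ y * y + x * y + x * x → + p ∣ y - x
      norm-∣ y d with + p ∣? x
      ... | no p∤x  = let w , w-root = rescale y d (inverse x p∤x) in contradiction w-root (no-root w)
      ... | yes p∣x = both-0 y d p∣x
      cube-injective : ∀ y → + p ∣ y * y * y - x * x * x → + p ∣ y - x
      cube-injective y d = [ (λ e → e) , norm-∣ y ]′
        (prime-∣ (y - x) (y * y + x * y + x * x) (∣-multiple 1ℤ d (solve (x ∷ y ∷ []))))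

    ∑ₚ-equalCubes : ∑ₚ equalCubes ≡ + p
    ∑ₚ-equalCubes = trans (∑ₚ-cong equalCubes-≡) (trans (∑ₚ-const 1ℤ) (ℤ.*-identityʳ (+ p)))

    -- The Möbius map x ↦ -1/(1+x) has order three and permutes 0 ↦ -1 ↦ ∞ ↦ 0;
    -- here 0 and -1 are made fixed points instead.
    data Möbius (x y : ℤ) : Set where
      fixed : + p ∣ x * (1ℤ + x) → y ≈ x → Möbius x y
      moved : ¬ + p ∣ x * (1ℤ + x) → (1ℤ + x) * y ≈ -1ℤ → Möbius x y

    möbius : ∀ x → ∃[ y ] Möbius x y
    möbius x with + p ∣? x * (1ℤ + x)
    ... | yes d = x , fixed d ≈-refl
    ... | no ¬d = from-inverse (inverse (1ℤ + x) (¬d ∘ ∣n⇒∣m*n x))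
      where
      from-inverse : (∃[ u ] (1ℤ + x) * u ≈ 1ℤ) → ∃[ y ] Möbius x y
      from-inverse (u , mod e) = - u , moved ¬d (mod (∣-multiple -1ℤ e (solve (x ∷ u ∷ []))))

    möbius-resp-≈ : ∀ {x y z} → y ≈ z → Möbius x y → Möbius x z
    möbius-resp-≈ y≈z (fixed d e) = fixed d (≈-trans (≈-sym y≈z) e)
    möbius-resp-≈ {x} y≈z (moved d e) = moved d (≈-trans (*-cong (≈-refl {1ℤ + x}) (≈-sym y≈z)) e)

    -- `y ≡ 0` would give `0 ≡ -1`, and `y ≡ -1` would give `1 + x ≡ 1`, hence `x ≡ 0`. Orbits of
    -- moved points thus avoid 0 and -1.
    moved-on : ∀ x y → ¬ + p ∣ x * (1ℤ + x) → (1ℤ + x) * y ≈ -1ℤ → ¬ + p ∣ y * (1ℤ + y)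
    moved-on x y d (mod e) = [ y≢0 , 1+y≢0 ]′ ∘ prime-∣ y (1ℤ + y)
      where
      y≢0 : ¬ + p ∣ y
      y≢0 f = p∤1 (∣-combine 1ℤ (- (1ℤ + x)) e f (solve (x ∷ y ∷ [])))
      1+y≢0 : ¬ + p ∣ 1ℤ + y
      1+y≢0 f = d (∣m⇒∣m*n {m = x} (1ℤ + x) (∣-combine -1ℤ (1ℤ + x) e f (solve (x ∷ y ∷ []))))

    fixed-on : ∀ {x y} → + p ∣ x * (1ℤ + x) → y ≈ x → + p ∣ y * (1ℤ + y)
    fixed-on d y≈x = ∣-resp-≈ (*-cong (≈-sym y≈x) (+-cong (≈-refl {1ℤ}) (≈-sym y≈x))) d

    -- Fixed and moved points cannot occur in the same orbit, so only the two uniform cases survive.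
    möbius³ : ∀ {x y z v} → Möbius x y → Möbius y z → Möbius z v → v ≈ x
    möbius³ (fixed d e) (moved f _) _           = contradiction (fixed-on d e) f
    möbius³ (fixed d e) (fixed f g) (moved h _) = contradiction (fixed-on f g) h
    möbius³ (fixed d e) (fixed f g) (fixed h i) = ≈-trans i (≈-trans g e)
    möbius³ {x} {y} (moved d e) (fixed f _) _                 = contradiction f (moved-on x y d e)
    möbius³ {y = y} {z} (moved d e) (moved f g) (fixed h _)   = contradiction h (moved-on y z f g)
    möbius³ {x} {y} {z} {v} (moved d (mod e)) (moved f (mod g)) (moved h (mod i)) =
      -- Eliminating `y` from the first two equations gives `(1 + z)x ≡ -1`, the equation that `v`
      -- satisfies; then `1 + z` is cancelled.
      mod (*-cancel-∣ (v - x) (h ∘ ∣n⇒∣m*n z)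
        (∣-combine 1ℤ 1ℤ i (∣-combine (- (1ℤ + x)) z g e refl) (solve (x ∷ y ∷ z ∷ v ∷ []))))

    p≡2+3M : ∃[ M ] + p ≡ + 2 + + 3 * M
    p≡2+3M = let M , eq = fixedPoints-order3 f f³≡id in M , trans eq (cong (_+ + 3 * M) ∑-fixed)
      where
      f : Fin p → Fin p
      f x = ⟦ proj₁ (möbius (residue x)) ⟧
      f-möbius : ∀ x → Möbius (residue x) (residue (f x))
      f-möbius x = möbius-resp-≈ (≈-sym (residue-⟦⟧ _)) (proj₂ (möbius (residue x)))
      f³≡id : ∀ x → f (f (f x)) ≡ x
      f³≡id x = residue-injective (möbius³ (f-möbius x) (f-möbius (f x)) (f-möbius (f (f x))))

      fixed⇒0,-1 : ∀ x → Möbius x x → + p ∣ x * (1ℤ + x)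
      fixed⇒0,-1 x (fixed d _)       = d
      -- A fixed point of the Möbius map itself satisfies `(1 + x)x ≡ -1`, so it would be a
      -- primitive cube root of unity.
      fixed⇒0,-1 x (moved _ (mod e)) =
        ⊥-elim (no-root x (∣-multiple 1ℤ e (solve (x ∷ []))))
      0,-1⇒fixed : ∀ {x y} → + p ∣ x * (1ℤ + x) → Möbius x y → y ≈ x
      0,-1⇒fixed d (fixed _ e) = e
      0,-1⇒fixed d (moved e _) = contradiction d e

      ∑-fixed : ∑[ x < p ] indicator (f x Fin.≟ x) ≡ + 2
      ∑-fixed = begin
        ∑[ x < p ] indicator (f x Fin.≟ x)
          ≡⟨ sum-cong-≗ {p} (λ x → indicator-cong (f x Fin.≟ x) (+ p ∣? residue x * (1ℤ + residue x))
               (λ eq → fixed⇒0,-1 (residue x) (möbius-resp-≈ (≈-reflexive (cong residue eq)) (f-möbius x)))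
               (λ d → residue-injective (0,-1⇒fixed d (f-möbius x)))) ⟩
        ∑ₚ (λ x → δ (x * (1ℤ + x)))
          -- The fixed points are the classes 0 and -1, distinct because `x` and `1 + x` differ by
          -- 1; `x - -1ℤ` computes to `x + 1ℤ`.
          ≡⟨ ∑ₚ-cong (λ x → trans
               (δ-* x (1ℤ + x) (λ (d , e) → p∤1 (∣-combine 1ℤ -1ℤ e d (solve (x ∷ [])))))
               (cong (λ u → δ x + δ u) (ℤ.+-comm 1ℤ x))) ⟩
        ∑ₚ (λ x → δ x + δ (x - -1ℤ))
          ≡⟨ ∑ₚ-+ δ (λ x → δ (x - -1ℤ)) ⟩
        ∑ₚ δ + ∑ₚ (λ x → δ (x - -1ℤ))
          ≡⟨ cong₂ _+_ ∑ₚ-δ₀ (∑ₚ-δ -1ℤ) ⟩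
        + 2 ∎

  cubeRootOfUnity? : (∃[ w ] CubeRootOfUnity w) ⊎ (∀ w → ¬ CubeRootOfUnity w)
  cubeRootOfUnity? with Fin.any? (λ (x : Fin p) → + p ∣? residue x * residue x + residue x + 1ℤ)
  ... | yes (x , d) = inj₁ (residue x , d)
  ... | no none     = inj₂ λ w d → none (⟦ w ⟧ , ∣-resp-≈
    (+-cong (+-cong (*-cong (≈-sym (residue-⟦⟧ w)) (≈-sym (residue-⟦⟧ w))) (≈-sym (residue-⟦⟧ w))) ≈-refl) d)

-- Remainders modulo 3 and conclusion

remainder-3 : ∀ {n r} → n % 3 ≡ r → ∃[ q ] + n ≡ + r + + 3 * q
remainder-3 {n} refl = + (n ℕ./ 3) , (begin
  + n                              ≡⟨ cong +_ (ℕ.m≡m%n+[m/n]*n n 3) ⟩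
  + (n % 3 ℕ.+ n ℕ./ 3 ℕ.* 3)      ≡⟨ ℤ.pos-+ (n % 3) (n ℕ./ 3 ℕ.* 3) ⟩
  + (n % 3) + + (n ℕ./ 3 ℕ.* 3)    ≡⟨ cong (λ m → + (n % 3) + m)
                                         (trans (ℤ.pos-* (n ℕ./ 3) 3) (ℤ.*-comm (+ (n ℕ./ 3)) (+ 3))) ⟩
  + (n % 3) + + 3 * + (n ℕ./ 3)    ∎)
  where open ≡-Reasoning

1≢2-mod-3 : ∀ {n} → (∃[ a ] n ≡ 1ℤ + + 3 * a) → (∃[ b ] n ≡ + 2 + + 3 * b) → ⊥
1≢2-mod-3 {n} (a , n≡1+3a) (b , n≡2+3b) = from-no (+ 3 ∣? 1ℤ) (divides (a - b) (begin
  1ℤ                                      ≡⟨ solve (a ∷ b ∷ []) ⟩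
  (+ 2 + + 3 * b) - (1ℤ + + 3 * a) + (a - b) * + 3
    ≡⟨ cong₂ (λ u v → u - v + (a - b) * + 3) n≡2+3b n≡1+3a ⟨
  n - n + (a - b) * + 3                   ≡⟨ cong (_+ (a - b) * + 3) (ℤ.+-inverseʳ n) ⟩
  0ℤ + (a - b) * + 3                      ≡⟨ ℤ.+-identityˡ _ ⟩
  (a - b) * + 3                           ∎))
  where open ≡-Reasoning

mainTheorem4 : (p : ℕ) → Prime p → 3 < p →
    (p % 3 ≡ 1 → A₂ p ≡ + 2 * (+ p) ^ 2 - + 2 * + p) × (p % 3 ≡ 2 → A₂ p ≡ 0ℤ)
-- The split is on the existence of a primitive cube root of unity. Each case determines `p` modulo
-- 3, so one of the two implications is evaluated and the other has a contradictory premise.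
mainTheorem4 p p-prime 3<p = [ with-root , without-root ]′ cubeRootOfUnity?
  where
  open LegendreSums p p-prime 3<p
  Claim = (p % 3 ≡ 1 → A₂ p ≡ + 2 * (+ p) ^ 2 - + 2 * + p) × (p % 3 ≡ 2 → A₂ p ≡ 0ℤ)

  with-root : (∃[ w ] CubeRootOfUnity w) → Claim
  with-root (w , w-root) =
    (λ _ → trans A₂-≡ (trans (cong (λ n → + p * n - + p * + p) ∑ₚ-equalCubes) (evaluate (+ p)))) ,
    (λ p%3≡2 → ⊥-elim (1≢2-mod-3 p≡1+3M (remainder-3 p%3≡2)))
    where
    open WithCubeRoot w w-root
    evaluate : ∀ q → q * (+ 3 * q - + 2) - q * q ≡ + 2 * (q * (q * 1ℤ)) - + 2 * q
    evaluate = solve-∀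

  without-root : (∀ w → ¬ CubeRootOfUnity w) → Claim
  without-root no-root =
    (λ p%3≡1 → ⊥-elim (1≢2-mod-3 (remainder-3 p%3≡1) p≡2+3M)) ,
    (λ _ → trans A₂-≡ (trans (cong (λ n → + p * n - + p * + p) ∑ₚ-equalCubes) (ℤ.+-inverseʳ (+ p * + p))))
    where
    open WithoutCubeRoot no-root
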